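{- The random ordered graph $(\mathbf{G},<)$ is a semi-retract of the canonically ordered atomless Boolean algebra $(\mathbf{B},<)$. Moreover, the functions witnessing this can be chosen to be order-preserving: there exist functions $\phi\colon G\to B$ and $\psi\colon B\to G$, both strictly increasing with respect to the respective linear orders $<$, such that $\phi$ respects quantifier-free types from $(\mathbf{G},<)$ to $(\mathbf{B},<)$, $\psi$ respects quantifier-free types from $(\mathbf{B},<)$ to $(\mathbf{G},<)$, and $\psi\circ\phi$ acts as the identity on the quantifier-free types of $(\mathbf{G},<)$.
   Context: Boolean algebras are considered in the signature $\{\wedge,\vee,\neg,0,1\}$; a Boolean algebra $\mathbf{A}$ carries the partial order $a_1\preceq a_2 \iff a_1\vee a_2=a_2$, and its atoms are the minimal nonzero elements. Every finite Boolean algebra is atomic, so each element is uniquely the join of a set of atoms. Given a finite Boolean algebra and a linear order on its atoms, its natural order is the linear order on the whole algebra obtained by extending the order of atoms anti-lexicographically to these atom-sets: for elements $a\neq b$ with atom sets $S_a,S_b$, $a<b$ iff the largest atom of the symmetric difference $S_a\triangle S_b$ lies in $S_b$. A naturally ordered finite Boolean algebra is a finite Boolean algebra equipped with such an order (in the signature $\{\wedge,\vee,\neg,0,1,<\}$). The class of finite naturally ordered Boolean algebras is a Fraïssé class; its Fraïssé limit (the unique countable homogeneous structure whose age is this class) is the canonically ordered atomless Boolean algebra $(\mathbf{B},<)$, with domain $B$. The random ordered graph $(\mathbf{G},<)=(G;E,<)$ is the Fraïssé limit of the class of all finite simple graphs (edge relation $E$) equipped with a linear order $<$ of the vertices. A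 function $f\colon C\to D$ between the domains of structures $\mathbf{C},\mathbf{D}$ respects (acts on) quantifier-free types if for any two tuples $\bar c_1,\bar c_2$ over $C$ of the same quantifier-free type in $\mathbf{C}$, the tuples $f(\bar c_1),f(\bar c_2)$ (componentwise images) have the same quantifier-free type in $\mathbf{D}$. A structure $\mathbf{C}$ is a semi-retract of $\mathbf{D}$ if there are quantifier-free type respecting functions $\phi\colon C\to D$ and $\psi\colon D\to C$ such that $\psi\circ\phi$ acts as the identity on quantifier-free types of $\mathbf{C}$, i.e. for every tuple $\bar c$ over $C$, $\psi(\phi(\bar c))$ has the same quantifier-free type in $\mathbf{C}$ as $\bar c$. -}

module Defs where

open import Data.Nat using (ℕ; suc)
open import Data.Bool using (Bool; true; false)
open import Data.Fin as Fin using (Fin)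
open import Data.Fin.Subset using (Subset; _∩_; _∪_; ∁; ⊥; ⊤)
open import Data.Vec using (lookup)
open import Data.Product using (Σ; ∃; ∃-syntax; _×_; _,_)
open import Data.Sum using (_⊎_)
open import Function using (_∘_)
open import Relation.Nullary using (Dec; ¬_)
open import Relation.Binary.PropositionalEquality using (_≡_)

_⇔_ : Set → Set → Set
P ⇔ Q = (P → Q) × (Q → P)

record OGraphStr : Set₁ where
  field
    V    : Set
    E    : V → V → Set
    _<_  : V → V → Set
open OGraphStr public

SameQFTypeG : (G : OGraphStr) {k : ℕ} → (Fin k → V G) → (Fin k → V G) → Set
SameQFTypeG G {k} a b = (i j : Fin k) →
    ((a i ≡ a j) ⇔ (b i ≡ b j))
  × (E G (a i) (a j) ⇔ E G (b i) (b j))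
  × (_<_ G (a i) (a j) ⇔ _<_ G (b i) (b j))

-- finite ordered graph on vertex set Fin n (ordered as in Fin);
-- every finite ordered graph is isomorphic to one of these
record FinOGraph (n : ℕ) : Set where
  field
    adj       : Fin n → Fin n → Bool
    adj-sym   : ∀ i j → adj i j ≡ adj j i
    adj-irr   : ∀ i → adj i i ≡ false
open FinOGraph public

EmbedsG : {n : ℕ} → FinOGraph n → (G : OGraphStr) → Set
EmbedsG {n} H G = Σ (Fin n → V G) λ f →
    ((i j : Fin n) → (f i ≡ f j) ⇔ (i ≡ j))
  × ((i j : Fin n) → E G (f i) (f j) ⇔ (adj H i j ≡ true))
  × ((i j : Fin n) → _<_ G (f i) (f j) ⇔ (i Fin.< j))

record AutG (G : OGraphStr) : Set where
  field
    σ     : V G → V G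
    σ⁻¹   : V G → V G
    invˡ  : ∀ x → σ⁻¹ (σ x) ≡ x
    invʳ  : ∀ x → σ (σ⁻¹ x) ≡ x
    presE : ∀ x y → E G x y ⇔ E G (σ x) (σ y)
    pres< : ∀ x y → _<_ G x y ⇔ _<_ G (σ x) (σ y)

-- (G,<) is the random ordered graph: the Fraïssé limit of the class of
-- finite ordered graphs (countable, age = that class, homogeneous)
record IsRandomOrderedGraph (G : OGraphStr) : Set₁ where
  field
    -- decidability of the atomic diagram (classically automatic)
    _≟_    : (x y : V G) → Dec (x ≡ y)
    E?     : (x y : V G) → Dec (E G x y)
    <?     : (x y : V G) → Dec (_<_ G x y)
    enum     : ℕ → V G
    enum-surj : ∀ x → ∃[ m ] enum m ≡ x
    -- age ⊆ finite ordered graphs (universal axioms)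
    E-irr   : ∀ x → ¬ E G x x
    E-sym   : ∀ x y → E G x y → E G y x
    <-irr   : ∀ x → ¬ _<_ G x x
    <-trans : ∀ x y z → _<_ G x y → _<_ G y z → _<_ G x z
    <-tri   : ∀ x y → _<_ G x y ⊎ x ≡ y ⊎ _<_ G y x
    universal : ∀ n (H : FinOGraph n) → EmbedsG H G
    -- homogeneity: isomorphisms between finite substructures (= pairs of
    -- tuples with equal qf type) extend to automorphisms
    homogeneous : ∀ k (a b : Fin k → V G) → SameQFTypeG G a b →
      Σ (AutG G) λ s → ∀ i → AutG.σ s (a i) ≡ b i

record OBAStr : Set₁ where
  field
    A    : Set
    _∧_  : A → A → A
    _∨_  : A → A → A
    ¬ᴮ   : A → A
    𝟘    : A
    𝟙    : A
    _≺_  : A → A → Set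
open OBAStr public

data Term (k : ℕ) : Set where
  var  : Fin k → Term k
  _∧ₜ_ : Term k → Term k → Term k
  _∨ₜ_ : Term k → Term k → Term k
  ¬ₜ   : Term k → Term k
  0ₜ   : Term k
  1ₜ   : Term k

eval : (B : OBAStr) {k : ℕ} → Term k → (Fin k → A B) → A B
eval B (var i)  a = a i
eval B (t ∧ₜ s) a = _∧_ B (eval B t a) (eval B s a)
eval B (t ∨ₜ s) a = _∨_ B (eval B t a) (eval B s a)
eval B (¬ₜ t)   a = ¬ᴮ B (eval B t a)
eval B 0ₜ       a = 𝟘 B
eval B 1ₜ       a = 𝟙 B

SameQFTypeB : (B : OBAStr) {k : ℕ} → (Fin k → A B) → (Fin k → A B) → Set
SameQFTypeB B {k} a b = (t s : Term k) →
    ((eval B t a ≡ eval B s a) ⇔ (eval B t b ≡ eval B s b))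
  × (_≺_ B (eval B t a) (eval B s a) ⇔ _≺_ B (eval B t b) (eval B s b))

-- natural (anti-lexicographic) order on the finite Boolean algebra of
-- subsets of Fin n, atoms ordered as in Fin: u < v iff the largest
-- element of the symmetric difference lies in v
_<ₐ_ : {n : ℕ} → Subset n → Subset n → Set
_<ₐ_ {n} u v = ∃[ i ] (lookup u i ≡ false) × (lookup v i ≡ true)
  × (∀ j → i Fin.< j → lookup u j ≡ lookup v j)

IsEmbB : {n : ℕ} (B : OBAStr) → (Subset (suc n) → A B) → Set
IsEmbB {n} B e =
    (∀ x y → e (x ∩ y) ≡ _∧_ B (e x) (e y))
  × (∀ x y → e (x ∪ y) ≡ _∨_ B (e x) (e y))
  × (∀ x → e (∁ x) ≡ ¬ᴮ B (e x))
  × (e ⊥ ≡ 𝟘 B)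
  × (e ⊤ ≡ 𝟙 B)
  × (∀ x y → e x ≡ e y → x ≡ y)
  × (∀ x y → (x <ₐ y) ⇔ _≺_ B (e x) (e y))

record AutB (B : OBAStr) : Set where
  field
    σ     : A B → A B
    σ⁻¹   : A B → A B
    invˡ  : ∀ x → σ⁻¹ (σ x) ≡ x
    invʳ  : ∀ x → σ (σ⁻¹ x) ≡ x
    pres∧ : ∀ x y → σ (_∧_ B x y) ≡ _∧_ B (σ x) (σ y)
    pres∨ : ∀ x y → σ (_∨_ B x y) ≡ _∨_ B (σ x) (σ y)
    pres¬ : ∀ x → σ (¬ᴮ B x) ≡ ¬ᴮ B (σ x)
    pres0 : σ (𝟘 B) ≡ 𝟘 B
    pres1 : σ (𝟙 B) ≡ 𝟙 B
    pres< : ∀ x y → _≺_ B x y ⇔ _≺_ B (σ x) (σ y)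

-- (B,<) is the canonically ordered atomless Boolean algebra: the Fraïssé
-- limit of the class of finite naturally ordered Boolean algebras
record IsCanonOrderedAtomlessBA (B : OBAStr) : Set₁ where
  field
    -- decidability of the atomic diagram (classically automatic)
    _≟_  : (x y : A B) → Dec (x ≡ y)
    ≺?   : (x y : A B) → Dec (_≺_ B x y)
    enum      : ℕ → A B
    enum-surj : ∀ x → ∃[ m ] enum m ≡ x
    -- age ⊆ class: the substructure generated by any finite tuple is
    -- isomorphic to a finite naturally ordered Boolean algebra
    age⊆ : ∀ k (a : Fin k → A B) → ∃[ n ] Σ (Subset (suc n) → A B) λ e →
        IsEmbB B e
      × (∀ x → (∃[ s ] e s ≡ x) ⇔ (∃[ t ] eval B t a ≡ x))
    universal : ∀ n → Σ (Subset (suc n) → A B) (IsEmbB B)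
    -- homogeneity: isomorphisms between finitely generated substructures
    -- (= pairs of generating tuples of equal qf type) extend to automorphisms
    homogeneous : ∀ k (a b : Fin k → A B) → SameQFTypeB B a b →
      Σ (AutB B) λ s → ∀ i → AutB.σ s (a i) ≡ b i

{-# OPTIONS --safe #-}
-- For φ, assign to an ordered graph the Boolean algebra whose atoms are its
-- pairs, its vertices and one further atom `rest`, with pairs below vertices
-- below `rest`, and send a vertex to the set of itself and its edges.  Then
-- x and y are adjacent iff x ≠ y and φ x ∧ φ y ≠ 0.  For an induced subgraph, the
-- largest atom below an atom of the subalgebra generated by its vertices is an
-- edge or vertex of the subgraph, or `rest`; so the ordered subalgebra depends
-- on the subgraph only.  For ψ, embed into G the ordered graph on B in which
-- x ≠ y are adjacent iff x ∧ y ≠ 0.  Both maps are obtained from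
-- universality and homogeneity along an enumeration.
module Submission where

open import Defs
open import Data.Bool using (Bool; true; false; not) renaming (_∧_ to _∧ᵇ_; _∨_ to _∨ᵇ_)
open import Data.Bool.Properties using (∨-identityʳ; ∨-zeroʳ)
open import Data.Empty using (⊥-elim)
open import Data.Fin as Fin using (Fin; zero; suc; toℕ; fromℕ; fromℕ<; inject₁)
open import Data.Fin.Properties as Fin using (any?; toℕ-fromℕ; toℕ-fromℕ<; toℕ-inject₁)
open import Data.Fin.Relation.Unary.Top using (view; ‵fromℕ; ‵inject₁)
open import Data.Fin.Subset using (Subset)
open import Data.Fin.Subset.Properties using (∩-comm)
open import Data.List as List using (List; []; _∷_; _++_; length; map; allFin; cartesianProductWith)
open import Data.List.Membership.Propositional using (_∈_)
open import Data.List.Membership.Propositional.Properties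
  using (∈-allFin; ∈-map⁺; ∈-++⁺ˡ; ∈-++⁺ʳ; ∈-cartesianProductWith⁺; ∈-tabulate⁺; ∈-lookup)
open import Data.List.Relation.Unary.All as All using (All; []; _∷_)
open import Data.List.Relation.Unary.AllPairs using (AllPairs; []; _∷_)
open import Data.List.Relation.Unary.Any using (here; there; index)
open import Data.List.Relation.Unary.Any.Properties using (lookup-index)
open import Data.Nat as ℕ using (ℕ; zero; suc; s≤s; _⊔_)
import Data.Nat.Properties as ℕ
open import Data.Product using (Σ; ∃; ∃-syntax; _×_; _,_; proj₁; proj₂)
open import Data.Sum using (_⊎_; inj₁; inj₂)
open import Data.Vec using ([]; _∷_; lookup; tabulate; zipWith; replicate)
open import Data.Vec.Properties using (lookup∘tabulate; tabulate-∘; tabulate-cong)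
open import Function using (_∘_; id)
open import Relation.Binary.Definitions using (tri<; tri≈; tri>)
open import Relation.Binary.PropositionalEquality
  using (_≡_; _≢_; refl; sym; trans; cong; cong₂; subst)
open import Relation.Nullary using (Dec; yes; no; ¬_; does; ¬?; _×-dec_)
open import Relation.Nullary.Decidable using (dec-true; dec-false)

-- Equivalences and strict linear orders

⇔-sym : {P Q : Set} → P ⇔ Q → Q ⇔ P
⇔-sym (f , g) = g , f

⇔-trans : {P Q R : Set} → P ⇔ Q → Q ⇔ R → P ⇔ R
⇔-trans (f , g) (h , k) = h ∘ f , g ∘ k

≡-⇔ : {X : Set} {x x′ y y′ : X} → x ≡ x′ → y ≡ y′ → (x ≡ y) ⇔ (x′ ≡ y′)
≡-⇔ refl refl = id , id

rel-⇔ : {X : Set} (R : X → X → Set) {x x′ y y′ : X} → x ≡ x′ → y ≡ y′ → R x y ⇔ R x′ y′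
rel-⇔ R refl refl = id , id

record StrictLinear {X : Set} (_⊏_ : X → X → Set) : Set where
  field
    irr : ∀ x → ¬ x ⊏ x
    tr  : ∀ x y z → x ⊏ y → y ⊏ z → x ⊏ z
    tri : ∀ x y → x ⊏ y ⊎ x ≡ y ⊎ y ⊏ x

Fin-linear : ∀ n → StrictLinear (Fin._<_ {n} {n})
Fin-linear n = record { irr = λ _ → ℕ.<-irrefl refl ; tr = λ _ _ _ → ℕ.<-trans ; tri = tri′ }
  where
  tri′ : ∀ (i j : Fin n) → i Fin.< j ⊎ i ≡ j ⊎ j Fin.< i
  tri′ i j with ℕ.<-cmp (toℕ i) (toℕ j)
  ... | tri< p _ _ = inj₁ p
  ... | tri≈ _ p _ = inj₂ (inj₁ (Fin.toℕ-injective p))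
  ... | tri> _ _ p = inj₂ (inj₂ p)

module _ {X Y : Set} {_⊏_ : X → X → Set} {_⊏′_ : Y → Y → Set}
         (LX : StrictLinear _⊏_) (LY : StrictLinear _⊏′_)
         (f : X → Y) (mono : ∀ x y → x ⊏ y → f x ⊏′ f y) where
  private
    module X = StrictLinear LX
    module Y = StrictLinear LY

  mono⇒injective : ∀ x y → f x ≡ f y → x ≡ y
  mono⇒injective x y eq with X.tri x y
  ... | inj₁ lt        = ⊥-elim (Y.irr _ (subst (f x ⊏′_) (sym eq) (mono x y lt)))
  ... | inj₂ (inj₁ p)  = p
  ... | inj₂ (inj₂ gt) = ⊥-elim (Y.irr _ (subst (f y ⊏′_) eq (mono y x gt)))

  mono⇒reflects : ∀ x y → f x ⊏′ f y → x ⊏ y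
  mono⇒reflects x y lt with X.tri x y
  ... | inj₁ p           = p
  ... | inj₂ (inj₁ refl) = ⊥-elim (Y.irr _ lt)
  ... | inj₂ (inj₂ gt)   = ⊥-elim (Y.irr _ (Y.tr _ _ _ lt (mono y x gt)))

-- Strictly sorted lists

module _ {X : Set} {_⊏_ : X → X → Set} (L : StrictLinear _⊏_) where
  open StrictLinear L

  -- Trichotomy detects duplicates, which are dropped, so the list stays strictly increasing. The
  -- last component, that nothing but `x` is added, keeps the head below the new tail in the
  -- recursive case.
  insertSorted : ∀ x ys → AllPairs _⊏_ ys → ∃[ zs ] AllPairs _⊏_ zs × x ∈ zs
    × (∀ {y} → y ∈ ys → y ∈ zs) × (∀ {z} → z ∈ zs → z ≡ x ⊎ z ∈ ys)
  insertSorted x [] _ = x ∷ [] , [] ∷ [] , here refl , (λ ()) , λ { (here p) → inj₁ p }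
  insertSorted x (y ∷ ys) (y⊏ys ∷ s) with tri x y
  ... | inj₁ x⊏y = x ∷ y ∷ ys , (x⊏y ∷ All.map (tr x y _ x⊏y) y⊏ys) ∷ y⊏ys ∷ s , here refl , there
                 , λ { (here p) → inj₁ p ; (there q) → inj₂ q }
  ... | inj₂ (inj₁ refl) = y ∷ ys , y⊏ys ∷ s , here refl , id , inj₂
  ... | inj₂ (inj₂ y⊏x) with insertSorted x ys s
  ...   | zs , s′ , x∈zs , ys⊆zs , zs⊆ =
        y ∷ zs , All.tabulate below ∷ s′ , there x∈zs
      , (λ { (here p) → here p ; (there q) → there (ys⊆zs q) })
      , λ { (here p) → inj₂ (here p) ; (there q) → weaken (zs⊆ q) }
    where
    below : ∀ {z} → z ∈ zs → y ⊏ z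
    below q with zs⊆ q
    ... | inj₁ refl = y⊏x
    ... | inj₂ r    = All.lookup y⊏ys r
    weaken : ∀ {z} → z ≡ x ⊎ z ∈ ys → z ≡ x ⊎ z ∈ (y ∷ ys)
    weaken (inj₁ p) = inj₁ p
    weaken (inj₂ r) = inj₂ (there r)

  -- Finite ordered graphs and finite set algebras come indexed increasingly by `Fin`, whereas a
  -- tuple may be unsorted and have repetitions.
  sortedCover : ∀ xs → ∃[ zs ] AllPairs _⊏_ zs × (∀ {x} → x ∈ xs → x ∈ zs)
  sortedCover [] = [] , [] , λ ()
  sortedCover (x ∷ xs) with sortedCover xs
  ... | ys , s , xs⊆ys with insertSorted x ys s
  ...   | zs , s′ , x∈zs , ys⊆zs , _ = zs , s′ , λ { (here refl) → x∈zs ; (there q) → ys⊆zs (xs⊆ys q) }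

lookup-mono : {X : Set} {R : X → X → Set} {xs : List X} → AllPairs R xs →
  ∀ i j → i Fin.< j → R (List.lookup xs i) (List.lookup xs j)
lookup-mono {xs = _ ∷ xs} (p ∷ _)  zero    (suc j) _         = All.lookup p (∈-lookup j)
lookup-mono {xs = _ ∷ _}  (_ ∷ ps) (suc i) (suc j) (s≤s i<j) = lookup-mono ps i j i<j

-- Extending finite realisations along an enumeration

bounded : ∀ {k} (f : Fin k → ℕ) → ∃[ N ] ∀ i → f i ℕ.< N
bounded {zero}  f = 0 , λ ()
bounded {suc k} f with bounded (f ∘ suc)
... | N , f<N = suc (f zero) ⊔ N , λ { zero    → ℕ.m≤m⊔n (suc (f zero)) N
                                     ; (suc i) → ℕ.≤-trans (f<N i) (ℕ.m≤n⊔m (suc (f zero)) N) }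

-- Partial realisations of longer and longer initial segments of the
-- enumeration are made coherent by moving each onto the previous one.
module CountableExtension {X C : Set} (enum : ℕ → X) (surj : ∀ x → ∃[ m ] enum m ≡ x)
  (Match : ∀ {k} → (Fin k → X) → (Fin k → C) → Set)
  (reindex : ∀ {k l} {a : Fin k → X} {f : Fin k → C} {a′ : Fin l → X} {f′ : Fin l → C}
             (π : Fin l → Fin k) → (∀ i → a (π i) ≡ a′ i) → (∀ i → f (π i) ≡ f′ i) →
             Match a f → Match a′ f′)
  (realise : ∀ {k} (a : Fin k → X) → Σ (Fin k → C) (Match a))
  (move : ∀ {k} {a : Fin k → X} {f g : Fin k → C} → Match a f → Match a g →
          Σ (C → C) λ σ → (∀ i → σ (g i) ≡ f i) ×
            (∀ {l} {b : Fin l → X} {h : Fin l → C} → Match b h → Match b (σ ∘ h)))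
  where

  initial : ∀ n → Fin n → X
  initial n i = enum (toℕ i)

  extend : ∀ n {f} → Match (initial n) f →
    Σ (Fin (suc n) → C) λ h → Match (initial (suc n)) h × (∀ i → h (inject₁ i) ≡ f i)
  extend n mf with realise (initial (suc n))
  -- Restricted along `inject₁`, the new realisation `g` matches the same segment as `f`, so the two
  -- can be compared by `move`.
  ... | g , mg with move mf (reindex inject₁ (λ i → cong enum (toℕ-inject₁ i)) (λ _ → refl) mg)
  ...   | σ , σg≡f , pres = σ ∘ g , pres mg , σg≡f

  segment : ∀ n → Σ (Fin n → C) (Match (initial n))
  segment zero    = realise (initial 0)
  segment (suc n) = let h , m , _ = extend n (proj₂ (segment n)) in h , m

  -- The value at `n` is the last entry of the segment of length `suc n`, the shortest one that
  -- contains index `n`.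
  limit : ℕ → C
  limit n = proj₁ (segment (suc n)) (fromℕ n)

  -- Each extension leaves earlier entries unchanged, so an entry keeps the value it had when it was
  -- last in its segment.
  segment≡limit : ∀ n i → proj₁ (segment n) i ≡ limit (toℕ i)
  segment≡limit (suc n) i with view i
  ... | ‵fromℕ     = cong limit (sym (toℕ-fromℕ n))
  ... | ‵inject₁ j = trans (proj₂ (proj₂ (extend n (proj₂ (segment n)))) j)
                       (trans (segment≡limit n j) (cong limit (sym (toℕ-inject₁ j))))

  abstract
    extension : X → C
    extension x = limit (proj₁ (surj x))

    -- The indices chosen by `surj` for the entries of `a` lie below some `N`, so `a` is a
    -- reindexing of the initial segment of length `N`.
    extension-match : ∀ {k} (a : Fin k → X) → Match a (extension ∘ a)
    extension-match a with bounded (proj₁ ∘ surj ∘ a)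
    ... | N , lt = reindex (λ i → fromℕ< (lt i))
        (λ i → trans (cong enum (toℕ-fromℕ< (lt i))) (proj₂ (surj (a i))))
        (λ i → trans (segment≡limit N (fromℕ< (lt i))) (cong limit (toℕ-fromℕ< (lt i))))
        (proj₂ (segment N))

-- Countable ordered graphs and their quantifier-free types

-- What is asked of the source of an embedding: it is applied to `G` itself for `φ` and to the graph
-- on the algebra for `ψ`.
record CountableOGraph (H : OGraphStr) : Set where
  field
    E?      : ∀ x y → Dec (E H x y)
    E-irr   : ∀ x → ¬ E H x x
    E-sym   : ∀ x y → E H x y → E H y x
    linear  : StrictLinear (_<_ H)
    enum    : ℕ → V H
    surj    : ∀ x → ∃[ m ] enum m ≡ x

module _ {G : OGraphStr} (rG : IsRandomOrderedGraph G) where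
  open IsRandomOrderedGraph rG

  random-countable : CountableOGraph G
  random-countable = record
    { E? = E? ; E-irr = E-irr ; E-sym = E-sym
    ; linear = record { irr = <-irr ; tr = <-trans ; tri = <-tri }
    ; enum = enum ; surj = enum-surj }

-- Compares tuples in two different graphs; when the graphs coincide it unfolds to `SameQFTypeG`.
SameType : (H G : OGraphStr) {k : ℕ} → (Fin k → V H) → (Fin k → V G) → Set
SameType H G {k} a b = (i j : Fin k) →
    ((a i ≡ a j) ⇔ (b i ≡ b j))
  × (E H (a i) (a j) ⇔ E G (b i) (b j))
  × (_<_ H (a i) (a j) ⇔ _<_ G (b i) (b j))

SameType-sym : ∀ {H G k} {a : Fin k → V H} {b : Fin k → V G} → SameType H G a b → SameType G H b a
SameType-sym m i j = let p , q , r = m i j in ⇔-sym p , ⇔-sym q , ⇔-sym r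

SameType-trans : ∀ {H G K k} {a : Fin k → V H} {b : Fin k → V G} {c : Fin k → V K} →
  SameType H G a b → SameType G K b c → SameType H K a c
SameType-trans m m′ i j =
  let p , q , r = m i j ; p′ , q′ , r′ = m′ i j in ⇔-trans p p′ , ⇔-trans q q′ , ⇔-trans r r′

SameType-reindex : ∀ {H G k l} {a : Fin k → V H} {f : Fin k → V G} {a′ : Fin l → V H} {f′ : Fin l → V G}
  (π : Fin l → Fin k) → (∀ i → a (π i) ≡ a′ i) → (∀ i → f (π i) ≡ f′ i) →
  SameType H G a f → SameType H G a′ f′
SameType-reindex {H} {G} π pa pf m i j =
  let p , q , r = m (π i) (π j) in
    ⇔-trans (⇔-sym (≡-⇔ (pa i) (pa j))) (⇔-trans p (≡-⇔ (pf i) (pf j)))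
  , ⇔-trans (⇔-sym (rel-⇔ (E H) (pa i) (pa j))) (⇔-trans q (rel-⇔ (E G) (pf i) (pf j)))
  , ⇔-trans (⇔-sym (rel-⇔ (_<_ H) (pa i) (pa j))) (⇔-trans r (rel-⇔ (_<_ G) (pf i) (pf j)))

injective-⇔ : {X Y : Set} (f : X → Y) → (∀ x y → f x ≡ f y → x ≡ y) → ∀ x y → (x ≡ y) ⇔ (f x ≡ f y)
injective-⇔ f inj x y = cong f , inj x y

inverse⇒injective : {X : Set} (σ σ⁻¹ : X → X) → (∀ x → σ⁻¹ (σ x) ≡ x) → ∀ x y → σ x ≡ σ y → x ≡ y
inverse⇒injective σ σ⁻¹ inv x y eq = trans (sym (inv x)) (trans (cong σ⁻¹ eq) (inv y))

dec-⇔ : {P : Set} (P? : Dec P) → (does P? ≡ true) ⇔ P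
dec-⇔ (yes p) = (λ _ → p) , λ _ → refl
dec-⇔ (no ¬p) = (λ ()) , λ p → ⊥-elim (¬p p)

⇔⇒≡ : {P Q : Set} (P? : Dec P) (Q? : Dec Q) → P ⇔ Q → does P? ≡ does Q?
⇔⇒≡ (yes p) (yes q) _ = refl
⇔⇒≡ (yes p) (no ¬q) (f , _) = ⊥-elim (¬q (f p))
⇔⇒≡ (no ¬p) (yes q) (_ , g) = ⊥-elim (¬p (g q))
⇔⇒≡ (no ¬p) (no ¬q) _ = refl

-- Embedding a countable ordered graph into the random one

module GraphEmbedding {H : OGraphStr} (cH : CountableOGraph H)
                      {G : OGraphStr} (rG : IsRandomOrderedGraph G) where
  private
    module H = CountableOGraph cH
    module G = IsRandomOrderedGraph rG

  -- The graph induced on a sorted cover of `a` embeds by universality; `idx` then locates each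
  -- entry of `a` in the cover.
  realise : ∀ {k} (a : Fin k → V H) → Σ (Fin k → V G) (SameType H G a)
  realise {k} a with sortedCover H.linear (List.tabulate a)
  ... | zs , sorted , cover = f ∘ idx
      , SameType-reindex {H} {G} idx (λ i → sym (lookup-index (a∈zs i))) (λ _ → refl) matched
    where
    z : Fin (length zs) → V H
    z = List.lookup zs
    mono : ∀ i j → i Fin.< j → _<_ H (z i) (z j)
    mono = lookup-mono sorted
    a∈zs : ∀ i → a i ∈ zs
    a∈zs i = cover (∈-tabulate⁺ i)
    idx : Fin k → Fin (length zs)
    idx i = index (a∈zs i)
    graph : FinOGraph (length zs)
    graph = record
      { adj     = λ i j → does (H.E? (z i) (z j))
      ; adj-sym = λ i j → ⇔⇒≡ (H.E? _ _) (H.E? _ _) (H.E-sym _ _ , H.E-sym _ _)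
      ; adj-irr = λ i → dec-false (H.E? (z i) (z i)) (H.E-irr _) }
    embedding : EmbedsG graph G
    embedding = G.universal _ graph
    f : Fin (length zs) → V G
    f = proj₁ embedding
    matched : SameType H G z f
    matched i j = let _ , f≡ , fE , f< = embedding in
        ⇔-trans (mono⇒injective (Fin-linear _) H.linear z mono i j , cong z) (⇔-sym (f≡ i j))
      , ⇔-trans (⇔-sym (dec-⇔ (H.E? (z i) (z j)))) (⇔-sym (fE i j))
      , ⇔-trans (mono⇒reflects (Fin-linear _) H.linear z mono i j , mono i j) (⇔-sym (f< i j))

  -- Both `g` and `f` have the type of `a`, so homogeneity gives an automorphism from one to the
  -- other, and automorphisms preserve all types.
  move : ∀ {k} {a : Fin k → V H} {f g : Fin k → V G} → SameType H G a f → SameType H G a g →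
    Σ (V G → V G) λ σ → (∀ i → σ (g i) ≡ f i) ×
      (∀ {l} {b : Fin l → V H} {h : Fin l → V G} → SameType H G b h → SameType H G b (σ ∘ h))
  move {f = f} {g} mf mg with G.homogeneous _ g f (SameType-trans {G} {H} {G} (SameType-sym {H} {G} mg) mf)
  ... | s , σg≡f = σ , σg≡f , λ m → SameType-trans {H} {G} {G} m λ i j →
        injective-⇔ σ (inverse⇒injective σ σ⁻¹ invˡ) _ _ , presE _ _ , pres< _ _
    where open AutG s

  open CountableExtension H.enum H.surj (SameType H G) (SameType-reindex {H} {G}) realise move public

-- The anti-lexicographic order on sets

-- Instantiated at Fin._<_ and the lookup functions this is _<ₐ_.
Below : {I : Set} → (I → I → Set) → (I → Bool) → (I → Bool) → Set
Below _⊏_ u v = ∃[ i ] (u i ≡ false) × (v i ≡ true) × (∀ j → i ⊏ j → u j ≡ v j)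

Below-cong : {I : Set} {_⊏_ _⊏′_ : I → I → Set} {u u′ v v′ : I → Bool} →
  (∀ i → u i ≡ u′ i) → (∀ i → v i ≡ v′ i) → (∀ i j → i ⊏′ j → i ⊏ j) →
  Below _⊏_ u v → Below _⊏′_ u′ v′
Below-cong u≡ v≡ ⊏⇒ (i , p , q , above) =
  i , trans (sym (u≡ i)) p , trans (sym (v≡ i)) q
    , λ j lt → trans (sym (u≡ j)) (trans (above j (⊏⇒ i j lt)) (v≡ j))

<ₐ-tabulate : ∀ {n} (u v : Fin n → Bool) → (tabulate u <ₐ tabulate v) ⇔ Below Fin._<_ u v
<ₐ-tabulate u v =
    Below-cong {_⊏_ = Fin._<_} {Fin._<_} (lookup∘tabulate u) (lookup∘tabulate v) (λ _ _ → id)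
  , Below-cong {_⊏_ = Fin._<_} {Fin._<_} (sym ∘ lookup∘tabulate u) (sym ∘ lookup∘tabulate v) (λ _ _ → id)

tabulate-injective : ∀ {n} {u v : Fin n → Bool} → tabulate u ≡ tabulate v → ∀ i → u i ≡ v i
tabulate-injective {u = u} {v} eq i =
  trans (sym (lookup∘tabulate u i)) (trans (cong (λ w → lookup w i) eq) (lookup∘tabulate v i))

Below-irr : {I : Set} {_⊏_ : I → I → Set} {u : I → Bool} → ¬ Below _⊏_ u u
Below-irr (_ , p , q , _) with trans (sym p) q
... | ()

<ₐ-linear : ∀ n → StrictLinear (_<ₐ_ {n})
<ₐ-linear n = record
  { irr = λ x → Below-irr {_⊏_ = Fin._<_} {lookup x} ; tr = tr ; tri = tri }
  where
  open StrictLinear (Fin-linear n) renaming (tri to triF) using ()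
  -- The larger of the two deciding positions decides between `x` and `z`.
  tr : ∀ x y z → x <ₐ y → y <ₐ z → x <ₐ z
  tr x y z (i , xi , yi , xy) (j , yj , zj , yz) with triF i j
  ... | inj₁ i<j = j , trans (xy j i<j) yj , zj
                 , λ k j<k → trans (xy k (ℕ.<-trans i<j j<k)) (yz k j<k)
  ... | inj₂ (inj₁ refl) = i , xi , zj , λ k i<k → trans (xy k i<k) (yz k i<k)
  ... | inj₂ (inj₂ j<i) = i , xi , trans (sym (yz i j<i)) yi
                 , λ k i<k → trans (xy k i<k) (yz k (ℕ.<-trans j<i i<k))
  cons : ∀ {n} (b c : Bool) {x y : Subset n} → x <ₐ y → (b ∷ x) <ₐ (c ∷ y)
  cons b c (i , p , q , above) = suc i , p , q , λ { (suc j) (s≤s lt) → above j lt }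
  tri : ∀ {n} (x y : Subset n) → x <ₐ y ⊎ x ≡ y ⊎ y <ₐ x
  tri [] [] = inj₂ (inj₁ refl)
  -- Later positions dominate, so the tails are compared first and the heads only break a tie.
  tri (b ∷ x) (c ∷ y) with tri x y
  ... | inj₁ lt        = inj₁ (cons b c lt)
  ... | inj₂ (inj₂ gt) = inj₂ (inj₂ (cons c b gt))
  tri (false ∷ x) (false ∷ y) | inj₂ (inj₁ refl) = inj₂ (inj₁ refl)
  tri (true  ∷ x) (true  ∷ y) | inj₂ (inj₁ refl) = inj₂ (inj₁ refl)
  tri (false ∷ x) (true  ∷ y) | inj₂ (inj₁ refl) = inj₁ (zero , refl , refl , λ { (suc j) _ → refl })
  tri (true  ∷ x) (false ∷ y) | inj₂ (inj₁ refl) = inj₂ (inj₂ (zero , refl , refl , λ { (suc j) _ → refl }))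

-- Boolean terms and their evaluation

rename : ∀ {k l} → (Fin l → Fin k) → Term l → Term k
rename π (var i)  = var (π i)
rename π (t ∧ₜ s) = rename π t ∧ₜ rename π s
rename π (t ∨ₜ s) = rename π t ∨ₜ rename π s
rename π (¬ₜ t)   = ¬ₜ (rename π t)
rename π 0ₜ       = 0ₜ
rename π 1ₜ       = 1ₜ

eval-rename : ∀ (B : OBAStr) {k l} (π : Fin l → Fin k) (t : Term l) {f : Fin k → A B} {f′ : Fin l → A B} →
  (∀ i → f (π i) ≡ f′ i) → eval B (rename π t) f ≡ eval B t f′
eval-rename B π (var i)  h = h i
eval-rename B π (t ∧ₜ s) h = cong₂ (_∧_ B) (eval-rename B π t h) (eval-rename B π s h)
eval-rename B π (t ∨ₜ s) h = cong₂ (_∨_ B) (eval-rename B π t h) (eval-rename B π s h)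
eval-rename B π (¬ₜ t)   h = cong (¬ᴮ B) (eval-rename B π t h)
eval-rename B π 0ₜ       h = refl
eval-rename B π 1ₜ       h = refl

eval-cong : ∀ (B : OBAStr) {k} (t : Term k) {f g : Fin k → A B} → (∀ i → f i ≡ g i) → eval B t f ≡ eval B t g
eval-cong B (var i)  h = h i
eval-cong B (t ∧ₜ s) h = cong₂ (_∧_ B) (eval-cong B t h) (eval-cong B s h)
eval-cong B (t ∨ₜ s) h = cong₂ (_∨_ B) (eval-cong B t h) (eval-cong B s h)
eval-cong B (¬ₜ t)   h = cong (¬ᴮ B) (eval-cong B t h)
eval-cong B 0ₜ       h = refl
eval-cong B 1ₜ       h = refl

eval-aut : ∀ (B : OBAStr) (s : AutB B) {k} (t : Term k) (f : Fin k → A B) →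
  AutB.σ s (eval B t f) ≡ eval B t (AutB.σ s ∘ f)
eval-aut B s (var i)  f = refl
eval-aut B s (t ∧ₜ u) f = trans (AutB.pres∧ s _ _) (cong₂ (_∧_ B) (eval-aut B s t f) (eval-aut B s u f))
eval-aut B s (t ∨ₜ u) f = trans (AutB.pres∨ s _ _) (cong₂ (_∨_ B) (eval-aut B s t f) (eval-aut B s u f))
eval-aut B s (¬ₜ t)   f = trans (AutB.pres¬ s _) (cong (¬ᴮ B) (eval-aut B s t f))
eval-aut B s 0ₜ       f = AutB.pres0 s
eval-aut B s 1ₜ       f = AutB.pres1 s

-- Set algebras are powers of this algebra, so a term in sets can be evaluated here, one atom at a
-- time.
𝟚 : OBAStr
𝟚 = record
  { A = Bool ; _∧_ = _∧ᵇ_ ; _∨_ = _∨ᵇ_ ; ¬ᴮ = not ; 𝟘 = false ; 𝟙 = true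
  ; _≺_ = λ x y → (x ≡ false) × (y ≡ true) }

tabulate-zipWith : ∀ (_∙_ : Bool → Bool → Bool) {n} (u v : Fin n → Bool) →
  zipWith _∙_ (tabulate u) (tabulate v) ≡ tabulate λ j → u j ∙ v j
tabulate-zipWith _∙_ {zero}  u v = refl
tabulate-zipWith _∙_ {suc n} u v = cong ((u zero ∙ v zero) ∷_) (tabulate-zipWith _∙_ (u ∘ suc) (v ∘ suc))

tabulate-const : ∀ n (b : Bool) → replicate n b ≡ tabulate λ _ → b
tabulate-const zero    b = refl
tabulate-const (suc n) b = cong (b ∷_) (tabulate-const n b)

eval-tabulate : ∀ (B : OBAStr) {n} {e : Subset (suc n) → A B} → IsEmbB B e →
  ∀ {k} (t : Term k) (u : Fin k → Fin (suc n) → Bool) →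
  eval B t (λ i → e (tabulate (u i))) ≡ e (tabulate λ j → eval 𝟚 t (λ i → u i j))
eval-tabulate B {n} {e} (e∧ , e∨ , e¬ , e0 , e1 , _) = go
  where
  ⟦_⟧ : ∀ {k} → Term k → (Fin k → Fin (suc n) → Bool) → Fin (suc n) → Bool
  ⟦ t ⟧ u j = eval 𝟚 t (λ i → u i j)
  go : ∀ {k} (t : Term k) (u : Fin k → Fin (suc n) → Bool) →
    eval B t (λ i → e (tabulate (u i))) ≡ e (tabulate (⟦ t ⟧ u))
  go (var i)  u = refl
  go (t ∧ₜ s) u = trans (cong₂ (_∧_ B) (go t u) (go s u)) (trans (sym (e∧ _ _)) (cong e (tabulate-zipWith _∧ᵇ_ (⟦ t ⟧ u) (⟦ s ⟧ u))))
  go (t ∨ₜ s) u = trans (cong₂ (_∨_ B) (go t u) (go s u)) (trans (sym (e∨ _ _)) (cong e (tabulate-zipWith _∨ᵇ_ (⟦ t ⟧ u) (⟦ s ⟧ u))))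
  go (¬ₜ t)   u = trans (cong (¬ᴮ B) (go t u)) (trans (sym (e¬ _)) (cong e (sym (tabulate-∘ not (⟦ t ⟧ u)))))
  go 0ₜ       u = trans (sym e0) (cong e (tabulate-const _ false))
  go 1ₜ       u = trans (sym e1) (cong e (tabulate-const _ true))

-- Comparing sets on a cofinal family of atoms

-- If every point lies weakly below a point of I at which u and v take the same
-- values, then a largest point of difference of u and v may be sought in I.
module Cofinal {I J : Set} {_⊏ᴵ_ : I → I → Set} {_⊏_ : J → J → Set} (L : StrictLinear _⊏_)
  (ι : I → J) (ι⇔ : ∀ i i′ → (i ⊏ᴵ i′) ⇔ (ι i ⊏ ι i′))
  (r : J → I) (r-above : ∀ q → q ≡ ι (r q) ⊎ q ⊏ ι (r q)) where
  open StrictLinear L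

  Stable : (J → Bool) → Set
  Stable u = ∀ q → u (ι (r q)) ≡ u q

  module _ {u v : J → Bool} (su : Stable u) (sv : Stable v) where

    ≗-⇔ : (∀ i → u (ι i) ≡ v (ι i)) ⇔ (∀ q → u q ≡ v q)
    ≗-⇔ = (λ h q → trans (sym (su q)) (trans (h (r q)) (sv q))) , λ h i → h (ι i)

    ⊏-r : ∀ {p} q → p ⊏ q → p ⊏ ι (r q)
    ⊏-r {p} q lt with r-above q
    ... | inj₁ eq = subst (p ⊏_) eq lt
    ... | inj₂ up = tr _ _ _ lt up

    r-⊏ : ∀ {p} q → ι (r q) ⊏ p → q ⊏ p
    r-⊏ {p} q lt with r-above q
    ... | inj₁ eq = subst (_⊏ p) (sym eq) lt
    ... | inj₂ up = tr _ _ _ up lt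

    Below-⇔ : Below _⊏ᴵ_ (u ∘ ι) (v ∘ ι) ⇔ Below _⊏_ u v
    Below-⇔ =
        (λ { (i , p , q , above) → ι i , p , q , λ j lt →
             trans (sym (su j)) (trans (above (r j) (proj₂ (ι⇔ _ _) (⊏-r j lt))) (sv j)) })
      , (λ { (j , p , q , above) → r j , trans (su j) p , trans (sv j) q , λ i lt →
             above (ι i) (r-⊏ j (proj₁ (ι⇔ _ _) lt)) })

-- The atoms and their order

data Point (X : Set) : Set where
  rest : Point X
  vert : X → Point X
  pair : X → X → Point X

mapPoint : {X Y : Set} → (X → Y) → Point X → Point Y
mapPoint f rest       = rest
mapPoint f (vert x)   = vert (f x)
mapPoint f (pair x y) = pair (f x) (f y)

-- Pairs are ordered lexicographically. The equation in `pair<ʳ` is an argument, so that the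
-- constructor can be matched on when the coordinates are images under a function.
data PointLt {X : Set} (_⊏_ : X → X → Set) : Point X → Point X → Set where
  pair<rest : ∀ {x y} → PointLt _⊏_ (pair x y) rest
  vert<rest : ∀ {x} → PointLt _⊏_ (vert x) rest
  pair<vert : ∀ {x y z} → PointLt _⊏_ (pair x y) (vert z)
  vert<vert : ∀ {x y} → x ⊏ y → PointLt _⊏_ (vert x) (vert y)
  pair<ˡ    : ∀ {x y x′ y′} → x ⊏ x′ → PointLt _⊏_ (pair x y) (pair x′ y′)
  pair<ʳ    : ∀ {x x′ y y′} → x ≡ x′ → y ⊏ y′ → PointLt _⊏_ (pair x y) (pair x′ y′)

PointLt-linear : {X : Set} {_⊏_ : X → X → Set} → StrictLinear _⊏_ → StrictLinear (PointLt _⊏_)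
PointLt-linear {X} {_⊏_} L = record { irr = irr′ ; tr = tr′ ; tri = tri′ }
  where
  open StrictLinear L
  irr′ : ∀ p → ¬ PointLt _⊏_ p p
  irr′ (vert x)   (vert<vert lt) = irr x lt
  irr′ (pair x y) (pair<ˡ lt)    = irr x lt
  irr′ (pair x y) (pair<ʳ _ lt)  = irr y lt
  tr′ : ∀ p q s → PointLt _⊏_ p q → PointLt _⊏_ q s → PointLt _⊏_ p s
  tr′ _ _ _ pair<vert       vert<rest       = pair<rest
  tr′ _ _ _ pair<vert       (vert<vert _)   = pair<vert
  tr′ _ _ _ (vert<vert _)   vert<rest       = vert<rest
  tr′ _ _ _ (vert<vert l)   (vert<vert m)   = vert<vert (tr _ _ _ l m)
  tr′ _ _ _ (pair<ˡ _)      pair<rest       = pair<rest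
  tr′ _ _ _ (pair<ˡ _)      pair<vert       = pair<vert
  tr′ _ _ _ (pair<ˡ l)      (pair<ˡ m)      = pair<ˡ (tr _ _ _ l m)
  tr′ _ _ _ (pair<ˡ l)      (pair<ʳ refl _) = pair<ˡ l
  tr′ _ _ _ (pair<ʳ _ _)    pair<rest       = pair<rest
  tr′ _ _ _ (pair<ʳ _ _)    pair<vert       = pair<vert
  tr′ _ _ _ (pair<ʳ refl _) (pair<ˡ m)      = pair<ˡ m
  tr′ _ _ _ (pair<ʳ refl l) (pair<ʳ refl m) = pair<ʳ refl (tr _ _ _ l m)
  tri′ : ∀ p q → PointLt _⊏_ p q ⊎ p ≡ q ⊎ PointLt _⊏_ q p
  tri′ rest       rest       = inj₂ (inj₁ refl)
  tri′ rest       (vert _)   = inj₂ (inj₂ vert<rest)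
  tri′ rest       (pair _ _) = inj₂ (inj₂ pair<rest)
  tri′ (vert _)   rest       = inj₁ vert<rest
  tri′ (vert _)   (pair _ _) = inj₂ (inj₂ pair<vert)
  tri′ (pair _ _) rest       = inj₁ pair<rest
  tri′ (pair _ _) (vert _)   = inj₁ pair<vert
  tri′ (vert x)   (vert y) with tri x y
  ... | inj₁ l           = inj₁ (vert<vert l)
  ... | inj₂ (inj₁ refl) = inj₂ (inj₁ refl)
  ... | inj₂ (inj₂ g)    = inj₂ (inj₂ (vert<vert g))
  tri′ (pair x y) (pair x′ y′) with tri x x′ | tri y y′
  ... | inj₁ l           | _                = inj₁ (pair<ˡ l)
  ... | inj₂ (inj₂ g)    | _                = inj₂ (inj₂ (pair<ˡ g))
  ... | inj₂ (inj₁ refl) | inj₁ l           = inj₁ (pair<ʳ refl l)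
  ... | inj₂ (inj₁ refl) | inj₂ (inj₁ refl) = inj₂ (inj₁ refl)
  ... | inj₂ (inj₁ refl) | inj₂ (inj₂ g)    = inj₂ (inj₂ (pair<ʳ refl g))

-- The comparison of two points uses only equalities and order relations between their coordinates.
-- Taking two tuples for `f` and `g` transports the order from one to the other.
PointLt-map : {X Y Z : Set} {_⊏_ : Y → Y → Set} {_⊏′_ : Z → Z → Set} (f : X → Y) (g : X → Z) →
  (∀ x y → f x ≡ f y → g x ≡ g y) → (∀ x y → f x ⊏ f y → g x ⊏′ g y) →
  ∀ p q → PointLt _⊏_ (mapPoint f p) (mapPoint f q) → PointLt _⊏′_ (mapPoint g p) (mapPoint g q)
PointLt-map f g ≡⇒ <⇒ (pair _ _) rest       pair<rest     = pair<rest
PointLt-map f g ≡⇒ <⇒ (vert _)   rest       vert<rest     = vert<rest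
PointLt-map f g ≡⇒ <⇒ (pair _ _) (vert _)   pair<vert     = pair<vert
PointLt-map f g ≡⇒ <⇒ (vert _)   (vert _)   (vert<vert l) = vert<vert (<⇒ _ _ l)
PointLt-map f g ≡⇒ <⇒ (pair _ _) (pair _ _) (pair<ˡ l)    = pair<ˡ (<⇒ _ _ l)
PointLt-map f g ≡⇒ <⇒ (pair _ _) (pair _ _) (pair<ʳ e l)  = pair<ʳ (≡⇒ _ _ e) (<⇒ _ _ l)

points : ∀ k → List (Point (Fin k))
points k = rest ∷ map vert (allFin k) ++ cartesianProductWith pair (allFin k) (allFin k)

∈-points : ∀ {k} (p : Point (Fin k)) → p ∈ points k
∈-points rest       = here refl
∈-points (vert i)   = there (∈-++⁺ˡ (∈-map⁺ vert (∈-allFin i)))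
∈-points {k} (pair i j) =
  there (∈-++⁺ʳ (map vert (allFin k)) (∈-cartesianProductWith⁺ pair (∈-allFin i) (∈-allFin j)))

-- The stars of a graph and the algebra they generate

module Incidence {H : OGraphStr} (cH : CountableOGraph H) where
  open CountableOGraph cH
  open StrictLinear linear

  _≟_ : (x y : V H) → Dec (x ≡ y)
  x ≟ y with tri x y
  ... | inj₁ lt        = no λ { refl → irr x lt }
  ... | inj₂ (inj₁ eq) = yes eq
  ... | inj₂ (inj₂ gt) = no λ { refl → irr x gt }

  _⊏_ : Point (V H) → Point (V H) → Set
  _⊏_ = PointLt (_<_ H)

  -- A vertex is sent to the join of its own atom and the atoms of its edges;
  -- pairs that are not edges belong to no star.
  star : V H → Point (V H) → Bool
  star u rest       = false
  star u (vert v)   = does (v ≟ u)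
  star u (pair x y) = does (E? x y) ∧ᵇ (does (x ≟ u) ∨ᵇ does (y ≟ u))

  star-nonedge : ∀ {u x y} → ¬ E H x y → star u (pair x y) ≡ false
  star-nonedge {x = x} {y} ¬e rewrite dec-false (E? x y) ¬e = refl

  star-left : ∀ {u x y} → E H x y → y ≢ u → star u (pair x y) ≡ does (x ≟ u)
  star-left {u} {x} {y} e ne rewrite dec-true (E? x y) e | dec-false (y ≟ u) ne = ∨-identityʳ _

  star-right : ∀ {u x y} → E H x y → x ≢ u → star u (pair x y) ≡ does (y ≟ u)
  star-right {u} {x} {y} e ne rewrite dec-true (E? x y) e | dec-false (x ≟ u) ne = refl

  -- The largest atom of difference is `vert y`: above it lie only `rest` and larger vertices, which
  -- belong to neither star.
  star-mono : ∀ x y → _<_ H x y → Below _⊏_ (star x) (star y)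
  star-mono x y x<y =
    vert y , dec-false (y ≟ x) (λ { refl → irr _ x<y }) , dec-true (y ≟ y) refl , agree
    where
    agree : ∀ q → vert y ⊏ q → star x q ≡ star y q
    agree rest     _               = refl
    agree (vert z) (vert<vert y<z) = trans
      (dec-false (z ≟ x) λ { refl → irr _ (tr _ _ _ x<y y<z) })
      (sym (dec-false (z ≟ y) λ { refl → irr _ y<z }))

  -- The characteristic function of the value of `t` at the stars of `a`, computed in the algebra of
  -- all sets of points.
  profile : ∀ {k} → Term k → (Fin k → V H) → Point (V H) → Bool
  profile t a p = eval 𝟚 t (λ i → star (a i) p)

  Eq Lt : ∀ {k} → (Fin k → V H) → Term k → Term k → Set
  Eq a t s = ∀ p → profile t a p ≡ profile s a p
  Lt a t s = Below _⊏_ (profile t a) (profile s a)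

  -- Every atom is dominated by an atom over a which lies in the same stars of
  -- members of a.  Hence the order on the algebra generated by these stars
  -- can be read off from a alone.
  module Support {k} (a : Fin k → V H) where

    Supports : Point (V H) → Point (Fin k) → Set
    Supports p p′ = (p ≡ mapPoint a p′ ⊎ p ⊏ mapPoint a p′)
      × (∀ i → star (a i) (mapPoint a p′) ≡ star (a i) p)

    Member : V H → Set
    Member v = ∃[ i ] a i ≡ v

    support-vert : ∀ v → Dec (Member v) → ∃ (Supports (vert v))
    support-vert v (yes (i , refl)) = vert i , inj₁ refl , λ _ → refl
    support-vert v (no ∄i) =
      rest , inj₂ vert<rest , λ l → sym (dec-false (v ≟ a l) λ eq → ∄i (l , sym eq))

    -- An edge with exactly one end in `a` lies in the same stars of members of `a` as that end. A
    -- non-edge, or an edge with no end in `a`, lies in none of these stars, like `rest`.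
    support-pair : ∀ x y → Dec (E H x y) → Dec (Member x) → Dec (Member y) → ∃ (Supports (pair x y))
    support-pair x y (no ¬e) _ _ = rest , inj₂ pair<rest , λ l → sym (star-nonedge ¬e)
    support-pair x y (yes e) (yes (i , refl)) (yes (j , refl)) = pair i j , inj₁ refl , λ _ → refl
    support-pair x y (yes e) (yes (i , refl)) (no ∄j) =
      vert i , inj₂ pair<vert , λ l → sym (star-left e λ eq → ∄j (l , sym eq))
    support-pair x y (yes e) (no ∄i) (yes (j , refl)) =
      vert j , inj₂ pair<vert , λ l → sym (star-right e λ eq → ∄i (l , sym eq))
    support-pair x y (yes e) (no ∄i) (no ∄j) =
      rest , inj₂ pair<rest , λ l → sym (trans (star-left e λ eq → ∄j (l , sym eq))
                                               (dec-false (x ≟ a l) λ eq → ∄i (l , sym eq)))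

    support : ∀ p → ∃ (Supports p)
    support rest       = rest , inj₁ refl , λ _ → refl
    support (vert v)   = support-vert v (any? λ i → a i ≟ v)
    support (pair x y) = support-pair x y (E? x y) (any? λ i → a i ≟ x) (any? λ i → a i ≟ y)

    -- The order is pulled back along `a`, whose entries may repeat and come in any order.
    _⊏ₐ_ : Point (Fin k) → Point (Fin k) → Set
    p ⊏ₐ q = mapPoint a p ⊏ mapPoint a q

    -- Whether an atom lies in the value of `t` depends only on which stars of members of `a`
    -- contain it, and `support` preserves this.
    stable : ∀ (t : Term k) p → profile t a (mapPoint a (proj₁ (support p))) ≡ profile t a p
    stable t p = eval-cong 𝟚 t (proj₂ (proj₂ (support p)))

    open Cofinal {_⊏ᴵ_ = _⊏ₐ_} (PointLt-linear linear) (mapPoint a) (λ _ _ → id , id)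
      (proj₁ ∘ support) (proj₁ ∘ proj₂ ∘ support)

    Eq-support : ∀ t s → (∀ p → profile t a (mapPoint a p) ≡ profile s a (mapPoint a p)) ⇔ Eq a t s
    Eq-support t s = ≗-⇔ (stable t) (stable s)

    Lt-support : ∀ t s →
      Below _⊏ₐ_ (profile t a ∘ mapPoint a) (profile s a ∘ mapPoint a) ⇔ Lt a t s
    Lt-support t s = Below-⇔ (stable t) (stable s)

  module _ {k} {a b : Fin k → V H} (same : SameQFTypeG H a b) where

    star-transfer : ∀ i p → star (a i) (mapPoint a p) ≡ star (b i) (mapPoint b p)
    star-transfer i rest       = refl
    star-transfer i (vert j)   = ⇔⇒≡ (_ ≟ _) (_ ≟ _) (proj₁ (same j i))
    star-transfer i (pair j l) = cong₂ _∧ᵇ_ (⇔⇒≡ (E? _ _) (E? _ _) (proj₁ (proj₂ (same j l))))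
      (cong₂ _∨ᵇ_ (⇔⇒≡ (_ ≟ _) (_ ≟ _) (proj₁ (same j i))) (⇔⇒≡ (_ ≟ _) (_ ≟ _) (proj₁ (same l i))))

    profile-transfer : ∀ t p → profile t a (mapPoint a p) ≡ profile t b (mapPoint b p)
    profile-transfer t p = eval-cong 𝟚 t λ i → star-transfer i p

    Eq-transfer : ∀ t s → Eq a t s → Eq b t s
    Eq-transfer t s eq = proj₁ (Support.Eq-support b t s) λ p →
      trans (sym (profile-transfer t p)) (trans (eq (mapPoint a p)) (profile-transfer s p))

    -- The comparison is restricted to points over `a`, carried to the corresponding points over
    -- `b`, whose memberships and order are fixed by the common type, and extended back to all
    -- points.
    Lt-transfer : ∀ t s → Lt a t s → Lt b t s
    Lt-transfer t s lt = proj₁ (Support.Lt-support b t s)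
      (Below-cong {_⊏_ = Support._⊏ₐ_ a} {Support._⊏ₐ_ b} (profile-transfer t) (profile-transfer s)
        (PointLt-map b a (λ i j → proj₂ (proj₁ (same i j))) (λ i j → proj₂ (proj₂ (proj₂ (same i j)))))
        (proj₂ (Support.Lt-support a t s) lt))

-- Mapping a graph into the atomless algebra by its stars

module AlgebraEmbedding {H : OGraphStr} (cH : CountableOGraph H)
                        {B : OBAStr} (cB : IsCanonOrderedAtomlessBA B) where
  open Incidence cH
  private
    module H = CountableOGraph cH
    module B = IsCanonOrderedAtomlessBA cB

  -- That is, `f` has in `B` the quantifier-free type that the stars of `a` have among sets of
  -- points.
  Realises : ∀ {k} → (Fin k → V H) → (Fin k → A B) → Set
  Realises a f = ∀ t s →
      ((eval B t f ≡ eval B s f) ⇔ Eq a t s)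
    × (_≺_ B (eval B t f) (eval B s f) ⇔ Lt a t s)

  Realises-reindex : ∀ {k l} {a : Fin k → V H} {f : Fin k → A B} {a′ : Fin l → V H} {f′ : Fin l → A B}
    (π : Fin l → Fin k) → (∀ i → a (π i) ≡ a′ i) → (∀ i → f (π i) ≡ f′ i) →
    Realises a f → Realises a′ f′
  Realises-reindex {a = a} {f} {a′} {f′} π pa pf m t s =
    let eq , lt = m (rename π t) (rename π s) in
      ⇔-trans (⇔-sym (≡-⇔ (ev t) (ev s))) (⇔-trans eq
        ( (λ h p → trans (sym (pr t p)) (trans (h p) (pr s p)))
        , (λ h p → trans (pr t p) (trans (h p) (sym (pr s p))))))
    , ⇔-trans (⇔-sym (rel-⇔ (_≺_ B) (ev t) (ev s))) (⇔-trans lt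
        ( Below-cong {_⊏_ = _⊏_} {_⊏_} (pr t) (pr s) (λ _ _ → id)
        , Below-cong {_⊏_ = _⊏_} {_⊏_} (sym ∘ pr t) (sym ∘ pr s) (λ _ _ → id)))
    where
    ev : ∀ t → eval B (rename π t) f ≡ eval B t f′
    ev t = eval-rename B π t pf
    pr : ∀ t p → profile (rename π t) a p ≡ profile t a′ p
    pr t p = eval-rename 𝟚 π t λ i → cong (λ u → star u p) (pa i)

  -- The points over `a`, listed increasingly, serve as atoms of a finite algebra embedded by
  -- universality, and `f i` is the image of the trace of a star on them. By `support` these points
  -- are cofinal, so no equation or comparison changes.
  realise : ∀ {k} (a : Fin k → V H) → Σ (Fin k → A B) (Realises a)
  realise {k} a with sortedCover (PointLt-linear H.linear) (map (mapPoint a) (points k))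
  -- The list of points contains `rest`, so there is at least one atom, as `universal` requires.
  ... | [] , _ , cover with cover (here refl)
  ...   | ()
  realise {k} a | z ∷ zs , sorted , cover = f , matched
    where
    open Support a
    ι : Fin (suc (length zs)) → Point (V H)
    ι = List.lookup (z ∷ zs)
    mono : ∀ i j → i Fin.< j → ι i ⊏ ι j
    mono = lookup-mono sorted
    covered : ∀ q → mapPoint a (proj₁ (support q)) ∈ (z ∷ zs)
    covered q = cover (∈-map⁺ (mapPoint a) (∈-points (proj₁ (support q))))
    r : Point (V H) → Fin (suc (length zs))
    r q = index (covered q)
    ι-r : ∀ q → mapPoint a (proj₁ (support q)) ≡ ι (r q)
    ι-r q = lookup-index (covered q)
    stableᵣ : ∀ t q → profile t a (ι (r q)) ≡ profile t a q
    stableᵣ t q = trans (cong (profile t a) (sym (ι-r q))) (stable t q)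
    above : ∀ q → q ≡ ι (r q) ⊎ q ⊏ ι (r q)
    above q = subst (λ p → q ≡ p ⊎ q ⊏ p) (ι-r q) (proj₁ (proj₂ (support q)))
    open Cofinal {_⊏ᴵ_ = Fin._<_} (PointLt-linear H.linear) ι
      (λ i j → mono i j , mono⇒reflects (Fin-linear _) (PointLt-linear H.linear) ι mono i j) r above
    embedding : Σ (Subset (suc (length zs)) → A B) (IsEmbB B)
    embedding = B.universal (length zs)
    e : Subset (suc (length zs)) → A B
    e = proj₁ embedding
    f : Fin k → A B
    f i = e (tabulate (star (a i) ∘ ι))
    ev : ∀ t → eval B t f ≡ e (tabulate (profile t a ∘ ι))
    ev t = eval-tabulate B (proj₂ embedding) t λ i → star (a i) ∘ ι
    matched : Realises a f
    matched t s = let _ , _ , _ , _ , _ , e-inj , e-< = proj₂ embedding in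
        ⇔-trans (≡-⇔ (ev t) (ev s)) (⇔-trans
          ((λ eq → tabulate-injective (e-inj _ _ eq)) , (λ h → cong e (tabulate-cong h)))
          (≗-⇔ (stableᵣ t) (stableᵣ s)))
      , ⇔-trans (rel-⇔ (_≺_ B) (ev t) (ev s)) (⇔-trans (⇔-sym (e-< _ _))
          (⇔-trans (<ₐ-tabulate _ _) (Below-⇔ (stableᵣ t) (stableᵣ s))))

  move : ∀ {k} {a : Fin k → V H} {f g : Fin k → A B} → Realises a f → Realises a g →
    Σ (A B → A B) λ σ → (∀ i → σ (g i) ≡ f i) ×
      (∀ {l} {b : Fin l → V H} {h : Fin l → A B} → Realises b h → Realises b (σ ∘ h))
  move {f = f} {g} mf mg with B.homogeneous _ g f (λ t s →
      ⇔-trans (proj₁ (mg t s)) (⇔-sym (proj₁ (mf t s))) , ⇔-trans (proj₂ (mg t s)) (⇔-sym (proj₂ (mf t s))))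
  ... | aut , σg≡f = σ , σg≡f , λ {_} {_} {h} m t s →
        ⇔-trans (⇔-sym (⇔-trans (injective-⇔ σ (inverse⇒injective σ σ⁻¹ invˡ) _ _)
          (≡-⇔ (eval-aut B aut t h) (eval-aut B aut s h)))) (proj₁ (m t s))
      , ⇔-trans (⇔-sym (⇔-trans (pres< _ _)
          (rel-⇔ (_≺_ B) (eval-aut B aut t h) (eval-aut B aut s h)))) (proj₂ (m t s))
    where open AutB aut

  open CountableExtension H.enum H.surj Realises Realises-reindex realise move public

  extension-respects : ∀ {k} (a b : Fin k → V H) → SameQFTypeG H a b →
    SameQFTypeB B (extension ∘ a) (extension ∘ b)
  extension-respects a b same t s =
      ⇔-trans (proj₁ (ma t s)) (⇔-trans (Eq-transfer same t s , Eq-transfer same′ t s) (⇔-sym (proj₁ (mb t s))))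
    , ⇔-trans (proj₂ (ma t s)) (⇔-trans (Lt-transfer same t s , Lt-transfer same′ t s) (⇔-sym (proj₂ (mb t s))))
    where
    ma : Realises a (extension ∘ a)
    ma = extension-match a
    mb : Realises b (extension ∘ b)
    mb = extension-match b
    same′ : SameQFTypeG H b a
    same′ = SameType-sym {H} {H} same

  pairMatch : ∀ x y → Realises (lookup (x ∷ y ∷ [])) (extension ∘ lookup (x ∷ y ∷ []))
  pairMatch x y = extension-match (lookup (x ∷ y ∷ []))

  extension-mono : ∀ x y → _<_ H x y → _≺_ B (extension x) (extension y)
  extension-mono x y x<y = proj₂ (proj₂ (pairMatch x y (var zero) (var (suc zero)))) (star-mono x y x<y)

  extension-disjoint : ∀ x y →
    (_∧_ B (extension x) (extension y) ≡ 𝟘 B) ⇔ (∀ p → star x p ∧ᵇ star y p ≡ false)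
  extension-disjoint x y = proj₁ (pairMatch x y (var zero ∧ₜ var (suc zero)) 0ₜ)

  -- The atom `pair x y` lies in both stars.
  edge⇒meet : ∀ x y → E H x y → ¬ (_∧_ B (extension x) (extension y) ≡ 𝟘 B)
  edge⇒meet x y e eq with trans (sym (both e)) (proj₁ (extension-disjoint x y) eq (pair x y))
    where
    both : E H x y → star x (pair x y) ∧ᵇ star y (pair x y) ≡ true
    both e rewrite dec-true (H.E? x y) e | dec-true (x ≟ x) refl | dec-true (y ≟ y) refl = ∨-zeroʳ _
  ... | ()

  -- A common atom would be a vertex equal to both `x` and `y`, or an edge with these two ends in
  -- some order.
  nonedge⇒disjoint : ∀ x y → x ≢ y → ¬ E H x y → _∧_ B (extension x) (extension y) ≡ 𝟘 B
  nonedge⇒disjoint x y x≢y ¬e = proj₂ (extension-disjoint x y) disjoint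
    where
    disjoint : ∀ p → star x p ∧ᵇ star y p ≡ false
    disjoint rest = refl
    disjoint (vert v) with v ≟ x | v ≟ y
    ... | yes refl | yes refl = ⊥-elim (x≢y refl)
    ... | yes _    | no _     = refl
    ... | no _     | _        = refl
    disjoint (pair u v) with H.E? u v | u ≟ x | u ≟ y | v ≟ x | v ≟ y
    ... | no _  | _        | _        | _        | _        = refl
    ... | yes e | yes refl | yes refl | _        | _        = ⊥-elim (x≢y refl)
    ... | yes e | yes refl | no _     | _        | yes refl = ⊥-elim (¬e e)
    ... | yes e | yes refl | no _     | _        | no _     = refl
    ... | yes e | no _     | yes refl | yes refl | _        = ⊥-elim (¬e (H.E-sym _ _ e))
    ... | yes e | no _     | no _     | yes refl | yes refl = ⊥-elim (x≢y refl)
    ... | yes e | no _     | no _     | yes refl | no _     = refl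
    ... | yes e | no _     | _        | no _     | _        = refl

-- The graph of intersecting elements of the algebra

module _ {B : OBAStr} (cB : IsCanonOrderedAtomlessBA B) where
  open IsCanonOrderedAtomlessBA cB

  -- Reduces the laws of order and meet in `B` to those of finite set algebras.
  common-embedding : ∀ {k} (a : Fin k → A B) → ∃[ n ] Σ (Subset (suc n) → A B) λ e →
    IsEmbB B e × (∀ i → ∃[ s ] e s ≡ a i)
  common-embedding a with age⊆ _ a
  ... | n , e , emb , image = n , e , emb , λ i → proj₂ (image (a i)) (var i , refl)

  ≺-linear : StrictLinear (_≺_ B)
  ≺-linear = record { irr = irr′ ; tr = tr′ ; tri = tri′ }
    where
    irr′ : ∀ x → ¬ _≺_ B x x
    irr′ x lt with common-embedding (lookup (x ∷ []))
    ... | n , e , (_ , _ , _ , _ , _ , _ , e-<) , pre with pre zero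
    ...   | u , eu = StrictLinear.irr (<ₐ-linear _) u
              (proj₂ (e-< u u) (proj₂ (rel-⇔ (_≺_ B) eu eu) lt))
    tr′ : ∀ x y z → _≺_ B x y → _≺_ B y z → _≺_ B x z
    tr′ x y z xy yz with common-embedding (lookup (x ∷ y ∷ z ∷ []))
    ... | n , e , (_ , _ , _ , _ , _ , _ , e-<) , pre with pre zero | pre (suc zero) | pre (suc (suc zero))
    ...   | u , eu | v , ev | w , ew = proj₁ (rel-⇔ (_≺_ B) eu ew) (proj₁ (e-< u w)
              (StrictLinear.tr (<ₐ-linear _) u v w
                (proj₂ (e-< u v) (proj₂ (rel-⇔ (_≺_ B) eu ev) xy))
                (proj₂ (e-< v w) (proj₂ (rel-⇔ (_≺_ B) ev ew) yz))))
    tri′ : ∀ x y → _≺_ B x y ⊎ x ≡ y ⊎ _≺_ B y x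
    tri′ x y with common-embedding (lookup (x ∷ y ∷ []))
    ... | n , e , (_ , _ , _ , _ , _ , _ , e-<) , pre with pre zero | pre (suc zero)
    ...   | u , eu | v , ev with StrictLinear.tri (<ₐ-linear _) u v
    ...     | inj₁ lt        = inj₁ (proj₁ (rel-⇔ (_≺_ B) eu ev) (proj₁ (e-< u v) lt))
    ...     | inj₂ (inj₁ eq) = inj₂ (inj₁ (trans (sym eu) (trans (cong e eq) ev)))
    ...     | inj₂ (inj₂ gt) = inj₂ (inj₂ (proj₁ (rel-⇔ (_≺_ B) ev eu) (proj₁ (e-< v u) gt)))

  meet-comm : ∀ x y → _∧_ B x y ≡ _∧_ B y x
  meet-comm x y with common-embedding (lookup (x ∷ y ∷ []))
  ... | n , e , (e∧ , _) , pre with pre zero | pre (suc zero)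
  ...   | u , eu | v , ev = trans (cong₂ (_∧_ B) (sym eu) (sym ev)) (trans (sym (e∧ u v))
            (trans (cong e (∩-comm u v)) (trans (e∧ v u) (cong₂ (_∧_ B) ev eu))))

  meetGraph : OGraphStr
  meetGraph = record
    { V = A B ; E = λ x y → x ≢ y × ¬ (_∧_ B x y ≡ 𝟘 B) ; _<_ = _≺_ B }

  meetGraph-countable : CountableOGraph meetGraph
  meetGraph-countable = record
    { E?     = λ x y → ¬? (x ≟ y) ×-dec ¬? (_∧_ B x y ≟ 𝟘 B)
    ; E-irr  = λ x (x≢x , _) → x≢x refl
    ; E-sym  = λ x y (x≢y , meet) → (x≢y ∘ sym) , meet ∘ trans (meet-comm x y)
    ; linear = ≺-linear
    ; enum   = enum
    ; surj   = enum-surj }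

  -- Adjacency is quantifier-free in `B`: it negates an equation of variables and the equation of
  -- their meet with `0ₜ`.
  meetGraph-type : ∀ {k} (a b : Fin k → A B) → SameQFTypeB B a b → SameQFTypeG meetGraph a b
  meetGraph-type a b same i j =
    let eq , lt = same (var i) (var j)
        meet , _ = same (var i ∧ₜ var j) 0ₜ
    in eq
     , ((λ (ne , m) → ne ∘ proj₂ eq , m ∘ proj₂ meet) , (λ (ne , m) → ne ∘ proj₁ eq , m ∘ proj₁ meet))
     , lt

-- The semi-retraction

theorem1 : (G : OGraphStr) (B : OBAStr) →
    IsRandomOrderedGraph G → IsCanonOrderedAtomlessBA B →
    Σ (V G → A B) λ φ → Σ (A B → V G) λ ψ →
    (∀ x y → _<_ G x y → _≺_ B (φ x) (φ y))
    × (∀ x y → _≺_ B x y → _<_ G (ψ x) (ψ y))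
    × (∀ (k : ℕ) (a b : Fin k → V G) → SameQFTypeG G a b →
    SameQFTypeB B (φ ∘ a) (φ ∘ b))
    × (∀ (k : ℕ) (a b : Fin k → A B) → SameQFTypeB B a b →
    SameQFTypeG G (ψ ∘ a) (ψ ∘ b))
    × (∀ (k : ℕ) (a : Fin k → V G) → SameQFTypeG G (ψ ∘ φ ∘ a) a)
theorem1 G B rG cB = φ , ψ , φ-mono , ψ-mono , (λ _ → Φ.extension-respects) , ψ-respects , round-trip
  where
  cG : CountableOGraph G
  cG = random-countable rG
  M : OGraphStr
  M = meetGraph cB
  module Φ = AlgebraEmbedding cG cB
  module Ψ = GraphEmbedding (meetGraph-countable cB) rG
  open IsRandomOrderedGraph rG using (E?; E-irr)
  φ : V G → A B
  φ = Φ.extension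
  ψ : A B → V G
  ψ = Ψ.extension
  φ-mono : ∀ x y → _<_ G x y → _≺_ B (φ x) (φ y)
  φ-mono = Φ.extension-mono
  ψ-type : ∀ {k} (a : Fin k → A B) → SameType M G a (ψ ∘ a)
  ψ-type = Ψ.extension-match
  ψ-mono : ∀ x y → _≺_ B x y → _<_ G (ψ x) (ψ y)
  ψ-mono x y = proj₁ (proj₂ (proj₂ (ψ-type (lookup (x ∷ y ∷ [])) zero (suc zero))))
  -- The types are compared along `ψ ∘ a`, `a`, `b`, `ψ ∘ b`, with the middle two read in `M`.
  ψ-respects : ∀ k (a b : Fin k → A B) → SameQFTypeB B a b → SameQFTypeG G (ψ ∘ a) (ψ ∘ b)
  ψ-respects k a b same = SameType-trans {G} {M} {G} (SameType-sym {M} {G} (ψ-type a))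
    (SameType-trans {M} {M} {G} (meetGraph-type cB a b same) (ψ-type b))
  φ-injective : ∀ x y → φ x ≡ φ y → x ≡ y
  φ-injective = mono⇒injective (CountableOGraph.linear cG) (≺-linear cB) φ φ-mono
  -- Thus `φ` embeds `G` into `M` as an ordered graph; since `ψ` embeds `M` into `G`, the composite
  -- preserves types.
  φ-type : ∀ {k} (a : Fin k → V G) → SameType M G (φ ∘ a) a
  φ-type a i j =
      (φ-injective _ _ , cong φ)
    , (edge , λ e → (λ eq → E-irr _ (subst (E G (a i)) (sym (φ-injective _ _ eq)) e)) , Φ.edge⇒meet _ _ e)
    , (mono⇒reflects (CountableOGraph.linear cG) (≺-linear cB) φ φ-mono _ _ , φ-mono _ _)
    where
    edge : E M (φ (a i)) (φ (a j)) → E G (a i) (a j)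
    edge (ne , meet) with E? (a i) (a j)
    ... | yes e = e
    ... | no ¬e = ⊥-elim (meet (Φ.nonedge⇒disjoint _ _ (ne ∘ cong φ) ¬e))
  round-trip : ∀ k (a : Fin k → V G) → SameQFTypeG G (ψ ∘ φ ∘ a) a
  round-trip k a = SameType-trans {G} {M} {G} (SameType-sym {M} {G} (ψ-type (φ ∘ a))) (φ-type a)
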